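{- Let $a\ne b$. The spherical tilings by $12$ edge congruent pentagons with edge lengths $a,a,a,a,b$ are, up to symmetries, given by the following five assignments of lengths to the edges of the dodecahedral pattern, in each of which the six listed edges have length $b$ and all other edges have length $a$: (1) $E_{1,5},E_{2,6},E_{3,4},E_{7,12},E_{8,9},E_{10,11}$; (2) $E_{1,5},E_{2,6},E_{3,4},E_{11,12},E_{7,8},E_{9,10}$; (3) $E_{1,5},E_{2,6},E_{3,4},E_{10,12},E_{7,11},E_{8,9}$; (4) $E_{1,5},E_{2,6},E_{3,7},E_{4,8},E_{11,12},E_{9,10}$; (5) $E_{1,5},E_{2,3},E_{6,11},E_{4,8},E_{7,12},E_{9,10}$.
   Context: A spherical tiling by $12$ pentagons (graph embedded in $S^2$ with all vertices of degree $\ge 3$, every tile a five-edged region enclosed by a simple closed curve; edges may be any nice curves) is combinatorially the dodecahedral pattern: tiles $P_1,\dots,P_{12}$, where $P_i$ with list $(n_1,\dots,n_5)$ has edges in cyclic order $E_{i,n_1},\dots,E_{i,n_5}$, $E_{i,j}=E_{j,i}$ being the common edge of $P_i$ and $P_j$, and (with $n_6=n_1$) $E_{i,n_k},E_{i,n_{k+1}}$ meet at the vertex $V_{i,n_k,n_{k+1}}$ of degree $3$ shared by $P_i,P_{n_k},P_{n_{k+1}}$: $P_1:(2,3,4,5,6)$; $P_2:(1,6,11,7,3)$; $P_3:(1,2,7,8,4)$; $P_4:(1,3,8,9,5)$; $P_5:(1,4,9,10,6)$; $P_6:(1,5,10,11,2)$; $P_7:(12,8,3,2,11)$; $P_8:(12,9,4,3,7)$;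 $P_9:(12,10,5,4,8)$; $P_{10}:(12,11,6,5,9)$; $P_{11}:(12,7,2,6,10)$; $P_{12}:(7,11,10,9,8)$. An edge congruent tiling is considered as an assignment of lengths to the $30$ edges such that all tiles are edge congruent, i.e. for any two tiles there is an adjacency-preserving correspondence of their edges that preserves lengths. No geometric realization by great arcs is required. "Up to symmetries" means up to symmetries of the dodecahedral pattern (including reflections). -}

module Defs where

open import Level using (Level)
open import Data.Bool using (if_then_else_; _∨_)
open import Data.Bool.Properties using (∨-comm)
open import Data.Fin using (Fin; zero; suc; toℕ)
import Data.Fin.Properties as Fin
open import Data.Fin.Permutation using (Permutation′; _⟨$⟩ʳ_)
open import Data.List using (List; []; _∷_; tabulate)
import Data.List.Membership.DecPropositional as ListMembership
open import Data.List.Relation.Binary.Permutation.Propositional using (_↭_)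
open import Data.Nat using (_%_)
import Data.Nat as ℕ
open import Data.Product using (Σ-syntax; _×_; _,_)
open import Data.Product.Properties using (≡-dec)
open import Data.Sum using (_⊎_)
open import Data.Vec using (Vec; []; _∷_; lookup)
open import Data.Vec.Membership.Propositional using (_∈_)
open import Data.Vec.Membership.Propositional.Properties using (∈-lookup)
open import Relation.Binary.PropositionalEquality using (_≡_; cong)
open import Relation.Nullary using (does)

private
  variable
    ℓ : Level
    L : Set ℓ

Tile : Set
Tile = Fin 12

pattern P₁  = zero
pattern P₂  = suc P₁
pattern P₃  = suc P₂
pattern P₄  = suc P₃
pattern P₅  = suc P₄
pattern P₆  = suc P₅
pattern P₇  = suc P₆
pattern P₈  = suc P₇
pattern P₉  = suc P₈
pattern P₁₀ = suc P₉
pattern P₁₁ = suc P₁₀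
pattern P₁₂ = suc P₁₁

-- The dodecahedral pattern: the k-th entry of `neighbours i` is the tile on the
-- other side of the k-th edge of i, the edges being listed in cyclic order.
neighbours : Tile → Vec Tile 5
neighbours P₁  = P₂  ∷ P₃  ∷ P₄  ∷ P₅  ∷ P₆  ∷ []
neighbours P₂  = P₁  ∷ P₆  ∷ P₁₁ ∷ P₇  ∷ P₃  ∷ []
neighbours P₃  = P₁  ∷ P₂  ∷ P₇  ∷ P₈  ∷ P₄  ∷ []
neighbours P₄  = P₁  ∷ P₃  ∷ P₈  ∷ P₉  ∷ P₅  ∷ []
neighbours P₅  = P₁  ∷ P₄  ∷ P₉  ∷ P₁₀ ∷ P₆  ∷ []
neighbours P₆  = P₁  ∷ P₅  ∷ P₁₀ ∷ P₁₁ ∷ P₂  ∷ []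
neighbours P₇  = P₁₂ ∷ P₈  ∷ P₃  ∷ P₂  ∷ P₁₁ ∷ []
neighbours P₈  = P₁₂ ∷ P₉  ∷ P₄  ∷ P₃  ∷ P₇  ∷ []
neighbours P₉  = P₁₂ ∷ P₁₀ ∷ P₅  ∷ P₄  ∷ P₈  ∷ []
neighbours P₁₀ = P₁₂ ∷ P₁₁ ∷ P₆  ∷ P₅  ∷ P₉  ∷ []
neighbours P₁₁ = P₁₂ ∷ P₇  ∷ P₂  ∷ P₆  ∷ P₁₀ ∷ []
neighbours P₁₂ = P₇  ∷ P₁₁ ∷ P₁₀ ∷ P₉  ∷ P₈  ∷ []

neighbour : Tile → Fin 5 → Tile
neighbour i k = lookup (neighbours i) k

Adjacent : Tile → Tile → Set
Adjacent i j = j ∈ neighbours i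

-- `length i j` is the length of the common edge E i j = E j i. Lengths live in
-- an arbitrary type, as they are only ever compared for equality.
record EdgeLengths {ℓ} (L : Set ℓ) : Set ℓ where
  field
    length     : ∀ i j → .(Adjacent i j) → L
    length-sym : ∀ i j .(p : Adjacent i j) .(q : Adjacent j i) →
                 length i j p ≡ length j i q

  side : Tile → Fin 5 → L
  side i k = length i (neighbour i k) (∈-lookup k (neighbours i))

open EdgeLengths public

-- The edges of a pentagon, numbered cyclically, that share a vertex.
Consecutive : Fin 5 → Fin 5 → Set
Consecutive k m = ℕ.suc (toℕ k) % 5 ≡ toℕ m ⊎ ℕ.suc (toℕ m) % 5 ≡ toℕ k

AdjacencyPreserving : Permutation′ 5 → Set
AdjacencyPreserving π =
  ∀ k m → Consecutive k m → Consecutive (π ⟨$⟩ʳ k) (π ⟨$⟩ʳ m)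

EdgeCongruent : EdgeLengths L → Tile → Tile → Set _
EdgeCongruent t i j =
  Σ[ π ∈ Permutation′ 5 ] AdjacencyPreserving π ×
    (∀ k → side t i k ≡ side t j (π ⟨$⟩ʳ k))

record IsEdgeCongruentTiling {ℓ} {L : Set ℓ} (t : EdgeLengths L)
                             (lengths : List L) : Set ℓ where
  field
    congruent    : ∀ i j → EdgeCongruent t i j
    tile-lengths : ∀ i → tabulate (side t i) ↭ lengths

-- A symmetry permutes the tiles and carries the boundary of each tile i onto the
-- boundary of its image, the k-th edge of i going to edge number `edge i k`.
-- Orientation may be reversed.
record Symmetry : Set where
  field
    tile            : Permutation′ 12
    edge            : Tile → Permutation′ 5
    edge-adjacency  : ∀ i → AdjacencyPreserving (edge i)
    edge-compatible : ∀ i k → neighbour (tile ⟨$⟩ʳ i) (edge i ⟨$⟩ʳ k)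
                            ≡ tile ⟨$⟩ʳ neighbour i k

_≈_ : EdgeLengths L → EdgeLengths L → Set _
s ≈ t = Σ[ σ ∈ Symmetry ] let open Symmetry σ in
  ∀ i k → side s i k ≡ side t (tile ⟨$⟩ʳ i) (edge i ⟨$⟩ʳ k)

infix 4 _≈_

open ListMembership (≡-dec (Fin._≟_ {12}) (Fin._≟_ {12})) using (_∈?_)

-- Length b on the listed edges (E i j being listed as (i , j) or (j , i)),
-- length a on all others.
assign : L → L → List (Tile × Tile) → EdgeLengths L
assign a b es = record
  { length     = λ i j _ → if does ((i , j) ∈? es) ∨ does ((j , i) ∈? es) then b else a
  ; length-sym = λ i j _ _ → cong (if_then b else a)
                   (∨-comm (does ((i , j) ∈? es)) (does ((j , i) ∈? es)))
  }

b-edges : Fin 5 → List (Tile × Tile)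
b-edges zero =
  (P₁ , P₅) ∷ (P₂ , P₆) ∷ (P₃ , P₄) ∷ (P₇ , P₁₂) ∷ (P₈ , P₉) ∷ (P₁₀ , P₁₁) ∷ []
b-edges (suc zero) =
  (P₁ , P₅) ∷ (P₂ , P₆) ∷ (P₃ , P₄) ∷ (P₁₁ , P₁₂) ∷ (P₇ , P₈) ∷ (P₉ , P₁₀) ∷ []
b-edges (suc (suc zero)) =
  (P₁ , P₅) ∷ (P₂ , P₆) ∷ (P₃ , P₄) ∷ (P₁₀ , P₁₂) ∷ (P₇ , P₁₁) ∷ (P₈ , P₉) ∷ []
b-edges (suc (suc (suc zero))) =
  (P₁ , P₅) ∷ (P₂ , P₆) ∷ (P₃ , P₇) ∷ (P₄ , P₈) ∷ (P₁₁ , P₁₂) ∷ (P₉ , P₁₀) ∷ []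
b-edges (suc (suc (suc (suc zero)))) =
  (P₁ , P₅) ∷ (P₂ , P₃) ∷ (P₆ , P₁₁) ∷ (P₄ , P₈) ∷ (P₇ , P₁₂) ∷ (P₉ , P₁₀) ∷ []

tiling : L → L → Fin 5 → EdgeLengths L
tiling a b n = assign a b (b-edges n)

{-# OPTIONS --safe #-}

-- As a ≢ b, pairing each tile with the neighbour across its b-edge is a perfect
-- matching of the adjacency graph of the tiles, the icosahedron. This graph has 125
-- perfect matchings; a backtracking search runs through them and finds for each a
-- symmetry that carries it to one of the five listed ones. These are inequivalent
-- because Σᵢ h(i)² takes the values 24, 14, 20, 6, 0 on them, where h(i) is the number
-- of edges of tile i that have b-edges at both ends, one of them on each side.
module Submission where

open import Defs
import Algebra.Properties.CommutativeMonoid.Sum as Sum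
open import Level using (Level)
open import Data.Bool using (Bool; T; true; false; if_then_else_)
import Data.Bool as Bool
open import Data.Bool.ListAction using (all; any)
open import Data.Bool.Properties using (if-float; T-≡)
open import Data.Empty using (⊥-elim)
open import Data.Fin using (Fin; zero; suc; toℕ; #_; _≟_)
open import Data.Fin.Permutation
  using (Permutation′; permutation; _⟨$⟩ʳ_; _⟨$⟩ˡ_; inverseʳ; _∘ₚ_)
  renaming (id to idₚ)
open import Data.Fin.Properties using (all?; any?; cast-is-id)
open import Data.List using (List; []; _∷_; tabulate; map; allFin; _ʳ++_)
import Data.List as List
open import Data.List.Membership.Propositional.Properties using (∈-allFin)
open import Data.List.Properties using (tabulate-cong; lookup-tabulate)
open import Data.List.Relation.Binary.Permutation.Propositional
  using (_↭_; ↭-reflexive; ↭-refl; ↭-trans; ↭⇒↭ₛ; prep)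
open import Data.List.Relation.Binary.Permutation.Propositional.Properties using (∷↭∷ʳ)
import Data.List.Relation.Binary.Permutation.Setoid as SetoidPermutation
import Data.List.Relation.Binary.Permutation.Setoid.Properties as SetoidPermutationₚ
open import Data.List.Relation.Unary.All using (All)
import Data.List.Relation.Unary.All as All
import Data.List.Relation.Unary.All.Properties as All
import Data.List.Relation.Unary.Any as Any
import Data.List.Relation.Unary.Any.Properties as Any
open import Data.Nat using (ℕ; _+_; _*_; _^_)
open import Data.Nat.GeneralisedArithmetic using (fold)
import Data.Nat as ℕ
open import Data.Nat.Properties using (+-0-commutativeMonoid)
open import Data.Nat.DivMod using (_mod_; _%_)
open import Data.Product using (Σ-syntax; ∃-syntax; _×_; _,_; proj₁; proj₂)
open import Data.Sum using (_⊎_)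
open import Data.Unit using (tt)
import Data.Vec as Vec
open import Data.Vec.Properties using (lookup∘tabulate)
open import Data.Vec using (Vec; []; _∷_; lookup)
open import Data.Vec.Relation.Unary.Any using (index)
open import Data.Vec.Relation.Unary.Any.Properties using (lookup-index)
open import Data.Vec.Membership.Propositional.Properties using (∈-lookup)
import Data.Vec.Membership.DecPropositional as VecMembership
open import Function using (_∘_; _⇔_; mk⇔)
open import Function.Bundles using (Equivalence; Injection)
open import Function.Properties.Inverse using (↔⇒↣)
open import Relation.Binary.PropositionalEquality
  using (_≡_; _≢_; refl; sym; trans; cong; subst; setoid; module ≡-Reasoning)
open import Relation.Nullary using (Dec; yes; no; does)
open import Relation.Nullary.Decidable
  using (True; fromWitness; isYes; toWitness; dec-true; does-⇔; _×-dec_; _⊎-dec_; _→-dec_)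

open Sum +-0-commutativeMonoid using (sum; sum-cong-≗; sum-permute)
open VecMembership (_≟_ {12}) using (_∈?_)

private
  variable
    ℓ : Level
    L : Set ℓ
    a b : L

-- Dihedral permutations of the edges of a pentagon, and incidences in the pattern.

injective : ∀ {n} (π : Permutation′ n) {x y} → π ⟨$⟩ʳ x ≡ π ⟨$⟩ʳ y → x ≡ y
injective π = Injection.injective (↔⇒↣ π)

consecutive? : ∀ k m → Dec (Consecutive k m)
consecutive? k m =
  (ℕ.suc (toℕ k) % 5 ℕ.≟ toℕ m) ⊎-dec (ℕ.suc (toℕ m) % 5 ℕ.≟ toℕ k)

affine : ℕ → ℕ → Fin 5 → Fin 5
affine s c k = (c + s * toℕ k) mod 5

-- k ↦ c + (−1)^e k modulo 5, with −1 written as 4.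
dihedral : Fin 2 → Fin 5 → Permutation′ 5
-- As s² = 1 modulo 5, the inverse of k ↦ c + sk is k ↦ -sc + sk, with -1 again written as 4.
dihedral e c = permutation (affine s (toℕ c)) (affine s (4 * s * toℕ c))
  (toWitness {a? = all? λ e → all? λ c → all? λ k →
     affine (4 ^ toℕ e) (toℕ c) (affine (4 ^ toℕ e) (4 * 4 ^ toℕ e * toℕ c) k) ≟ k} tt e c)
  (toWitness {a? = all? λ e → all? λ c → all? λ k →
     affine (4 ^ toℕ e) (4 * 4 ^ toℕ e * toℕ c) (affine (4 ^ toℕ e) (toℕ c) k) ≟ k} tt e c)
  where s = 4 ^ toℕ e

dihedral-adjacency : ∀ e c → AdjacencyPreserving (dihedral e c)
dihedral-adjacency = toWitness {a? = all? λ e → all? λ c → all? λ k → all? λ m →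
  consecutive? k m →-dec consecutive? (dihedral e c ⟨$⟩ʳ k) (dihedral e c ⟨$⟩ʳ m)} tt

-- Turns the b-edge of one tile onto that of another. As the other four lengths are all a, this
-- suffices for edge congruence.
rotation : ∀ p q → ∃[ c ] dihedral zero c ⟨$⟩ʳ p ≡ q
rotation = toWitness {a? = all? λ p → all? λ q → any? λ c →
  dihedral zero c ⟨$⟩ʳ p ≟ q} tt

neighbour-injective : ∀ i k m → neighbour i k ≡ neighbour i m → k ≡ m
neighbour-injective = toWitness {a? = all? λ i → all? λ k → all? λ m →
  (neighbour i k ≟ neighbour i m) →-dec (k ≟ m)} tt

neighbour-sym : ∀ i k → ∃[ m ] neighbour (neighbour i k) m ≡ i
neighbour-sym = toWitness {a? = all? λ i → all? λ k → any? λ m →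
  neighbour (neighbour i k) m ≟ i} tt

-- Pentagons with a single edge marked b.

mark : L → L → Fin 5 → Fin 5 → L
mark a b p k = if does (p ≟ k) then b else a

mark-hit : ∀ p → mark a b p p ≡ b
mark-hit {a = a} {b = b} p = cong (if_then b else a) (dec-true (p ≟ p) refl)

mark≡b⇒hit : a ≢ b → ∀ {p k} → mark a b p k ≡ b → p ≡ k
mark≡b⇒hit a≢b {p} {k} eq with p ≟ k
... | yes p≡k = p≡k
... | no  _   = ⊥-elim (a≢b eq)

mark-permute : ∀ (π : Permutation′ 5) {p q} → π ⟨$⟩ʳ p ≡ q →
               ∀ k → mark a b p k ≡ mark a b q (π ⟨$⟩ʳ k)
mark-permute {a = a} {b = b} π {p} refl k = cong (if_then b else a)
  (does-⇔ (mk⇔ (cong (π ⟨$⟩ʳ_)) (injective π)) (p ≟ k) (π ⟨$⟩ʳ p ≟ π ⟨$⟩ʳ k))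

mark-↭ : ∀ p → tabulate (mark a b p) ↭ a ∷ a ∷ a ∷ a ∷ b ∷ []
mark-↭ zero                         = ∷↭∷ʳ _ _
mark-↭ (suc zero)                   = prep _ (∷↭∷ʳ _ _)
mark-↭ (suc (suc zero))             = prep _ (prep _ (∷↭∷ʳ _ _))
mark-↭ (suc (suc (suc zero)))       = prep _ (prep _ (prep _ (∷↭∷ʳ _ _)))
mark-↭ (suc (suc (suc (suc zero)))) = ↭-refl

-- The permutation of lists gives a bijection `π` of positions. The b-edge is the one that `π` sends
-- to the last position, where the list a, a, a, a, b has its b.
↭-mark : (f : Fin 5 → L) → tabulate f ↭ a ∷ a ∷ a ∷ a ∷ b ∷ [] →
         ∃[ p ] ∀ k → f k ≡ mark a b p k
↭-mark {L = L} {a = a} {b = b} f f↭ = π ⟨$⟩ˡ last , λ k → begin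
  f k                                              ≡⟨ lookup-f k ⟩
  List.lookup (tabulate f) k                       ≡⟨ onIndices-lookup (↭⇒↭ₛ f↭) k ⟩
  List.lookup (a ∷ a ∷ a ∷ a ∷ b ∷ []) (π ⟨$⟩ʳ k)  ≡⟨ lookup-mark (π ⟨$⟩ʳ k) ⟩
  mark a b last (π ⟨$⟩ʳ k)                         ≡⟨ mark-permute π (inverseʳ π) k ⟨
  mark a b (π ⟨$⟩ˡ last) k                         ∎
  where
  open ≡-Reasoning
  open SetoidPermutation (setoid L) using (onIndices)
  open SetoidPermutationₚ (setoid L) using (onIndices-lookup)

  π : Permutation′ 5
  π = onIndices (↭⇒↭ₛ f↭)

  last : Fin 5
  last = # 4

  lookup-f : ∀ k → f k ≡ List.lookup (tabulate f) k
  lookup-f k = trans (sym (lookup-tabulate f k))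
    (cong (List.lookup (tabulate f)) (cast-is-id _ k))

  lookup-mark : ∀ k → List.lookup (a ∷ a ∷ a ∷ a ∷ b ∷ []) k ≡ mark a b last k
  lookup-mark zero                         = refl
  lookup-mark (suc zero)                   = refl
  lookup-mark (suc (suc zero))             = refl
  lookup-mark (suc (suc (suc zero)))       = refl
  lookup-mark (suc (suc (suc (suc zero)))) = refl

-- Tilings as a choice of one b-edge in each tile, and the five listed choices.

Marks : L → L → EdgeLengths L → (Tile → Fin 5) → Set _
Marks a b t p = ∀ i k → side t i k ≡ mark a b (p i) k

marks⇒tiling : ∀ {t : EdgeLengths L} {p} → Marks a b t p →
               IsEdgeCongruentTiling t (a ∷ a ∷ a ∷ a ∷ b ∷ [])
marks⇒tiling {t = t} {p = p} marks = record
  { congruent    = λ i j → let c , pᵢ↦pⱼ = rotation (p i) (p j) in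
      dihedral zero c , dihedral-adjacency zero c , λ k →
      trans (marks i k)
        (trans (mark-permute (dihedral zero c) pᵢ↦pⱼ k) (sym (marks j _)))
  ; tile-lengths = λ i →
      ↭-trans (↭-reflexive (tabulate-cong (marks i))) (mark-↭ (p i))
  }

tiling⇒marks : ∀ {t : EdgeLengths L} →
               IsEdgeCongruentTiling t (a ∷ a ∷ a ∷ a ∷ b ∷ []) →
               Σ[ p ∈ (Tile → Fin 5) ] Marks a b t p
tiling⇒marks {t = t} isTiling =
  (λ i → proj₁ (marked i)) , (λ i → proj₂ (marked i))
  where marked = λ i → ↭-mark (side t i) (IsEdgeCongruentTiling.tile-lengths isTiling i)

-- Entry i of row n is the position of the b-edge of tile i in the tiling n.
b-positions : Vec (Vec (Fin 5) 12) 5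
b-positions =
  (# 3 ∷ # 1 ∷ # 4 ∷ # 1 ∷ # 0 ∷ # 4 ∷ # 0 ∷ # 1 ∷ # 4 ∷ # 1 ∷ # 4 ∷ # 0 ∷ []) ∷
  (# 3 ∷ # 1 ∷ # 4 ∷ # 1 ∷ # 0 ∷ # 4 ∷ # 1 ∷ # 4 ∷ # 1 ∷ # 4 ∷ # 0 ∷ # 1 ∷ []) ∷
  (# 3 ∷ # 1 ∷ # 4 ∷ # 1 ∷ # 0 ∷ # 4 ∷ # 4 ∷ # 1 ∷ # 4 ∷ # 0 ∷ # 1 ∷ # 2 ∷ []) ∷
  (# 3 ∷ # 1 ∷ # 2 ∷ # 2 ∷ # 0 ∷ # 4 ∷ # 2 ∷ # 2 ∷ # 1 ∷ # 4 ∷ # 0 ∷ # 1 ∷ []) ∷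
  (# 3 ∷ # 4 ∷ # 1 ∷ # 2 ∷ # 0 ∷ # 3 ∷ # 0 ∷ # 2 ∷ # 1 ∷ # 4 ∷ # 3 ∷ # 0 ∷ []) ∷ []

b-position : Fin 5 → Tile → Fin 5
b-position n i = lookup (lookup b-positions n) i

b-partner : Fin 5 → Tile → Tile
b-partner n i = neighbour i (b-position n i)

-- Equality in `L` cannot be decided, so the table is checked by evaluation for the lengths `false`
-- and `true`; the choice between a and b is then pushed through the conditional.
tiling-marks : ∀ n → Marks a b (tiling a b n) (b-position n)
tiling-marks {a = a} {b = b} n i k = begin
  side (tiling a b n) i k
    ≡⟨ if-float (if_then b else a) _ {true} {false} ⟨
  (if side (tiling false true n) i k then b else a)
    ≡⟨ cong (if_then b else a) (boolean n i k) ⟩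
  mark a b (b-position n i) k
    ∎
  where
  open ≡-Reasoning
  boolean : ∀ n i k → side (tiling false true n) i k ≡ does (b-position n i ≟ k)
  boolean = toWitness {a? = all? λ n → all? λ i → all? λ k →
    side (tiling false true n) i k Bool.≟ does (b-position n i ≟ k)} tt

-- The b-edges form a perfect matching of the tiles.

module _ {p : Tile → Fin 5} (t : EdgeLengths L) where

  length-cong : ∀ i {j k} → j ≡ k → .(q : Adjacent i j) .(r : Adjacent i k) →
                length t i j q ≡ length t i k r
  length-cong i refl q r = refl

  -- Both sides measure one edge, seen from its two tiles.
  crossing : ∀ i k m → neighbour (neighbour i k) m ≡ i →
             side t i k ≡ side t (neighbour i k) m
  crossing i k m eq = trans
    (length-sym t i j (∈-lookup k (neighbours i)) j~i)
    (length-cong j (sym eq) j~i (∈-lookup m (neighbours j)))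
    where
    j = neighbour i k
    j~i : Adjacent j i
    j~i = subst (Adjacent j) eq (∈-lookup m (neighbours j))

  -- The edge of length b leading from i to j is also an edge of j, at position m. The tile j has
  -- only one b-edge, so m is `p j`.
  mutual-partners : a ≢ b → Marks a b t p → ∀ i j →
                    neighbour i (p i) ≡ j → neighbour j (p j) ≡ i
  mutual-partners {a = a} {b = b} a≢b marks i j refl
    with m , back ← neighbour-sym i (p i) =
    subst (λ q → neighbour j q ≡ i) (sym (mark≡b⇒hit a≢b pⱼ-hit)) back
    where
    pⱼ-hit : mark a b (p j) m ≡ b
    pⱼ-hit = trans (sym (marks j m)) (trans (sym (crossing i (p i) m back))
      (trans (marks i (p i)) (mark-hit (p i))))

-- Soundness of the backtracking search.

T-if⁻ : ∀ {x y z} → T x → T (if x then y else z) → T y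
T-if⁻ {true} _ y = y

-- The search returns a Boolean rather than a decision, since a decision would hold on
-- to the proofs of all branches visited. It is opaque because comparing types that
-- mention it would otherwise run it.
module Backtracking {n m} (compatible : Fin n × Fin m → Fin n × Fin m → Bool)
                    (leaf : List (Fin n × Fin m) → Bool) where

  opaque
    exhausts : List (Fin n) → List (Fin n × Fin m) → Bool
    exhausts []       uvs = leaf uvs
    exhausts (i ∷ is) uvs = all
      (λ x → if all (compatible (i , x)) uvs then exhausts is ((i , x) ∷ uvs) else true)
      (allFin m)

  module _ (f : Fin n → Fin m) (consistent : ∀ i j → T (compatible (i , f i) (j , f j))) where

    graph : Fin n → Fin n × Fin m
    graph i = i , f i

    opaque
      unfolding exhausts

      -- Follow the branch that always chooses the value of `f`. Consistency keeps it from being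
      -- pruned, so its leaf has been tested. The reversed append mirrors the accumulator, which
      -- receives new choices at the front.
      exhausts⇒leaf-from : ∀ is js → T (exhausts is (map graph js)) →
                           T (leaf (map graph (is ʳ++ js)))
      exhausts⇒leaf-from []       js search = search
      exhausts⇒leaf-from (i ∷ is) js search = exhausts⇒leaf-from is (i ∷ js)
        (T-if⁻ (All.all⁻ _ (All.map⁺ (All.universal (consistent i) js)))
          (All.lookup (All.all⁺ _ (allFin m) search) (∈-allFin (f i))))

    exhausts⇒leaf : exhausts (allFin n) [] ≡ true →
                    leaf (map graph (allFin n ʳ++ [])) ≡ true
    exhausts⇒leaf search =
      Equivalence.to T-≡ (exhausts⇒leaf-from (allFin n) [] (Equivalence.from T-≡ search))

    All-graph : ∀ {P : Fin n × Fin m → Set} →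
                All P (map graph (allFin n ʳ++ [])) → ∀ i → P (graph i)
    All-graph ps i = All.lookup (All.map⁻ ps) (Any.reverse⁺ (∈-allFin i))

-- Symmetries of the dodecahedral pattern.

-- The edge maps are sought among the ten dihedral permutations, so that a symmetry can be given by
-- its tile permutation alone.
Respects : Permutation′ 12 → Set
Respects π = ∀ i → ∃[ e ] ∃[ c ] ∀ k →
  neighbour (π ⟨$⟩ʳ i) (dihedral e c ⟨$⟩ʳ k) ≡ π ⟨$⟩ʳ neighbour i k

respects? : ∀ π → Dec (Respects π)
respects? π = all? λ i → any? λ e → any? λ c → all? λ k →
  neighbour (π ⟨$⟩ʳ i) (dihedral e c ⟨$⟩ʳ k) ≟ π ⟨$⟩ʳ neighbour i k

fromTables : (f g : Vec Tile 12) →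
             {True (all? λ i → lookup f (lookup g i) ≟ i)} →
             {True (all? λ i → lookup g (lookup f i) ≟ i)} →
             Permutation′ 12
fromTables f g {l} {r} =
  permutation (lookup f) (lookup g) (toWitness l) (toWitness r)

symmetry : (π : Permutation′ 12) → {True (respects? π)} → Symmetry
symmetry π {r} = record
  { tile            = π
  ; edge            = λ i → let e , c , _ = respects i in dihedral e c
  ; edge-adjacency  = λ i → let e , c , _ = respects i in dihedral-adjacency e c
  ; edge-compatible = λ i → let _ , _ , compatible = respects i in compatible
  }
  where
  respects : Respects π
  respects = toWitness r

identity : Symmetry
identity = record
  { tile            = idₚ
  ; edge            = λ _ → idₚ
  ; edge-adjacency  = λ _ _ _ km → km
  ; edge-compatible = λ _ _ → refl
  }

infixr 9 _⨾_

_⨾_ : Symmetry → Symmetry → Symmetry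
σ ⨾ τ = record
  { tile            = σ.tile ∘ₚ τ.tile
  ; edge            = λ i → σ.edge i ∘ₚ τ.edge (σ.tile ⟨$⟩ʳ i)
  ; edge-adjacency  = λ i k m → τ.edge-adjacency _ _ _ ∘ σ.edge-adjacency i k m
  ; edge-compatible = λ i k → trans (τ.edge-compatible _ _)
      (cong (τ.tile ⟨$⟩ʳ_) (σ.edge-compatible i k))
  }
  where
  module σ = Symmetry σ
  module τ = Symmetry τ

-- The rotation by one fifth of a turn about the axis through the centres of `P₁` and `P₁₂`.
fivefold : Symmetry
fivefold = symmetry (fromTables
  (P₁ ∷ P₃ ∷ P₄ ∷ P₅ ∷ P₆ ∷ P₂ ∷ P₈ ∷ P₉ ∷ P₁₀ ∷ P₁₁ ∷ P₇ ∷ P₁₂ ∷ [])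
  (P₁ ∷ P₆ ∷ P₂ ∷ P₃ ∷ P₄ ∷ P₅ ∷ P₁₁ ∷ P₇ ∷ P₈ ∷ P₉ ∷ P₁₀ ∷ P₁₂ ∷ []))

-- The half turn about the axis through the midpoint of the common edge of `P₁` and `P₂`.
halfTurn : Symmetry
halfTurn = symmetry (fromTables table table)
  where table = P₂ ∷ P₁ ∷ P₆ ∷ P₁₁ ∷ P₇ ∷ P₃ ∷ P₅ ∷ P₁₀ ∷ P₁₂ ∷ P₈ ∷ P₄ ∷ P₉ ∷ []

-- The central inversion, which reverses orientation.
antipodal : Symmetry
antipodal = symmetry (fromTables table table)
  where table = P₁₂ ∷ P₉ ∷ P₁₀ ∷ P₁₁ ∷ P₇ ∷ P₈ ∷ P₅ ∷ P₆ ∷ P₂ ∷ P₃ ∷ P₄ ∷ P₁ ∷ []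

powers : Symmetry → ℕ → List Symmetry
powers σ = List.iterate (σ ⨾_) identity

-- Only half of the 120 symmetries, but enough to bring each matching into the list.
symmetries : List Symmetry
symmetries = powers fivefold 5 ⊗ powers halfTurn 2 ⊗ powers fivefold 5 ⊗ powers antipodal 2
  where
  infixr 5 _⊗_
  _⊗_ : List Symmetry → List Symmetry → List Symmetry
  _⊗_ = List.cartesianProductWith _⨾_

tileMap : Symmetry → Tile → Tile
tileMap σ i = Symmetry.tile σ ⟨$⟩ʳ i

-- The search through the perfect matchings.

-- The last clause prunes as soon as two tiles claim the same partner, even before a position is
-- chosen for that partner.
MatchingConstraint : Tile × Fin 5 → Tile × Fin 5 → Set
MatchingConstraint (i , p) (j , q) =
  (neighbour i p ≡ j → neighbour j q ≡ i) ×
  (neighbour j q ≡ i → neighbour i p ≡ j) ×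
  (neighbour i p ≡ neighbour j q → i ≡ j)

matchingConstraint? : ∀ u v → Dec (MatchingConstraint u v)
matchingConstraint? (i , p) (j , q) =
  ((neighbour i p ≟ j) →-dec (neighbour j q ≟ i)) ×-dec
  ((neighbour j q ≟ i) →-dec (neighbour i p ≟ j)) ×-dec
  ((neighbour i p ≟ neighbour j q) →-dec (i ≟ j))

CarriesMatching : Vec Tile 12 → Fin 5 → Tile × Fin 5 → Set
CarriesMatching f n (i , p) = b-partner n (lookup f i) ≡ lookup f (neighbour i p)

carriesMatching? : ∀ f n ip → Dec (CarriesMatching f n ip)
carriesMatching? f n (i , p) = b-partner n (lookup f i) ≟ lookup f (neighbour i p)

-- Tabulated so that each image is computed only once in the search.
tileTable : Symmetry → Vec Tile 12
tileTable σ = Vec.tabulate (tileMap σ)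

isCarried : Vec Tile 12 → Fin 5 → List (Tile × Fin 5) → Bool
isCarried f n = all (isYes ∘ carriesMatching? f n)

opaque
  isListed : List (Vec Tile 12) → List (Tile × Fin 5) → Bool
  isListed fs ips = any (λ f → any (λ n → isCarried f n ips) (allFin 5)) fs

  isListed⇒carries : ∀ σs ips → isListed (map tileTable σs) ips ≡ true →
                     ∃[ σ ] ∃[ n ] All (CarriesMatching (tileTable σ) n) ips
  isListed⇒carries σs ips found =
    let σ , foundσ  = Any.satisfied (Any.map⁻
          (Any.any⁻ (λ f → any (λ n → isCarried f n ips) (allFin 5)) (map tileTable σs)
            (Equivalence.from T-≡ found)))
        n , carries = Any.satisfied
          (Any.any⁻ (λ n → isCarried (tileTable σ) n ips) (allFin 5) foundσ)
    in σ , n , All.map toWitness (All.all⁺ _ ips carries)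

module Matchings = Backtracking (λ u v → isYes (matchingConstraint? u v))
                                (isListed (map tileTable symmetries))

opaque
  unfolding Matchings.exhausts isListed

  all-matchings-listed : Matchings.exhausts (allFin 12) [] ≡ true
  all-matchings-listed =
    toWitness {a? = Matchings.exhausts (allFin 12) [] Bool.≟ true} tt

-- From matchings back to tilings.

module _ {a b : L} {t : EdgeLengths L} {p : Tile → Fin 5}
         (a≢b : a ≢ b) (marks : Marks a b t p) where

  matching-consistent : ∀ i j → T (isYes (matchingConstraint? (i , p i) (j , p j)))
  matching-consistent i j = fromWitness
    ( partners i j , partners j i
    -- The common partner has one partner of its own, which is both i and j.
    , λ eq → trans (sym (partners i _ eq)) (partners j _ refl))
    where partners = mutual-partners t a≢b marks

  -- An edge of a tile is determined by the tile across it, so carrying partners to partners carries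
  -- b-edges to b-edges; all remaining edges have length a.
  carries⇒≈ : ∀ σ n → (∀ i → CarriesMatching (tileTable σ) n (i , p i)) →
              t ≈ tiling a b n
  carries⇒≈ σ n carries = σ , λ i k →
    trans (marks i k)
      (trans (mark-permute (edge i) (edge-carries i) k)
        (sym (tiling-marks {a = a} {b = b} n (tileMap σ i) (edge i ⟨$⟩ʳ k))))
    where
    open Symmetry σ
    open ≡-Reasoning
    edge-carries : ∀ i → edge i ⟨$⟩ʳ p i ≡ b-position n (tileMap σ i)
    edge-carries i = neighbour-injective (tileMap σ i) _ _ (begin
      neighbour (tileMap σ i) (edge i ⟨$⟩ʳ p i)  ≡⟨ edge-compatible i (p i) ⟩
      tileMap σ (neighbour i (p i))              ≡⟨ lookup∘tabulate (tileMap σ) _ ⟨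
      lookup (tileTable σ) (neighbour i (p i))   ≡⟨ carries i ⟨
      b-partner n (lookup (tileTable σ) i)       ≡⟨ cong (b-partner n) (lookup∘tabulate (tileMap σ) i) ⟩
      b-partner n (tileMap σ i)                  ∎)

  listed : ∃[ n ] t ≈ tiling a b n
  listed =
    let σ , n , carries = isListed⇒carries symmetries _
          (Matchings.exhausts⇒leaf p matching-consistent all-matchings-listed)
    in n , carries⇒≈ σ n (Matchings.All-graph p matching-consistent carries)

-- An invariant that separates the five tilings.

-- For neighbouring i and j, both partners are then common neighbours of i and j, hence lie at the
-- ends of their common edge. They lie at different ends, since no tile has two b-edges. In this
-- form only adjacency and partners occur, which symmetries preserve.
Linked : Fin 5 → Tile → Tile → Set
Linked n i j = Adjacent j (b-partner n i) × Adjacent i (b-partner n j)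

linked? : ∀ n i j → Dec (Linked n i j)
linked? n i j = (b-partner n i ∈? neighbours j) ×-dec (b-partner n j ∈? neighbours i)

links : Fin 5 → Tile → Fin 5 → ℕ
links n i k = if does (linked? n i (neighbour i k)) then 1 else 0

squaredLinks : Fin 5 → ℕ
squaredLinks n = sum λ i → sum (links n i) ^ 2

squaredLinks-injective : ∀ m n → squaredLinks m ≡ squaredLinks n → m ≡ n
squaredLinks-injective = toWitness {a? = all? λ m → all? λ n →
  (squaredLinks m ℕ.≟ squaredLinks n) →-dec (m ≟ n)} tt

module _ (σ : Symmetry) where
  open Symmetry σ

  adjacent-preserved : ∀ {i j} → Adjacent i j → Adjacent (tileMap σ i) (tileMap σ j)
  adjacent-preserved {i} i~j = subst (Adjacent (tileMap σ i))
    (trans (edge-compatible i (index i~j)) (cong (tileMap σ) (sym (lookup-index i~j))))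
    (∈-lookup (edge i ⟨$⟩ʳ index i~j) (neighbours (tileMap σ i)))

  adjacent-reflected : ∀ {i j} → Adjacent (tileMap σ i) (tileMap σ j) → Adjacent i j
  adjacent-reflected {i} {j} σi~σj =
    subst (Adjacent i) (injective tile σ-eq) (∈-lookup k (neighbours i))
    where
    -- The edge of i that `edge i` sends to the edge between the two image tiles.
    k = edge i ⟨$⟩ˡ index σi~σj
    open ≡-Reasoning
    σ-eq : tileMap σ (neighbour i k) ≡ tileMap σ j
    σ-eq = begin
      tileMap σ (neighbour i k)                ≡⟨ edge-compatible i k ⟨
      neighbour (tileMap σ i) (edge i ⟨$⟩ʳ k)  ≡⟨ cong (neighbour (tileMap σ i)) (inverseʳ (edge i)) ⟩
      neighbour (tileMap σ i) (index σi~σj)    ≡⟨ lookup-index σi~σj ⟨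
      tileMap σ j                              ∎

module _ {a b : L} (a≢b : a ≢ b) m n (m≈n : tiling a b m ≈ tiling a b n) where
  private σ = proj₁ m≈n
  open Symmetry σ
  open ≡-Reasoning

  -- The b-edge of i goes to an edge of length b, and the image tile has only one such edge.
  b-partner-preserved : ∀ i → b-partner n (tileMap σ i) ≡ tileMap σ (b-partner m i)
  b-partner-preserved i = trans
    (cong (neighbour (tileMap σ i)) (mark≡b⇒hit a≢b hit))
    (edge-compatible i (b-position m i))
    where
    k = edge i ⟨$⟩ʳ b-position m i
    hit : mark a b (b-position n (tileMap σ i)) k ≡ b
    hit = begin
      mark a b (b-position n (tileMap σ i)) k     ≡⟨ tiling-marks {a = a} {b = b} n _ k ⟨
      side (tiling a b n) (tileMap σ i) k         ≡⟨ proj₂ m≈n i (b-position m i) ⟨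
      side (tiling a b m) i (b-position m i)      ≡⟨ tiling-marks {a = a} {b = b} m i _ ⟩
      mark a b (b-position m i) (b-position m i)  ≡⟨ mark-hit (b-position m i) ⟩
      b                                           ∎

  linked-⇔ : ∀ i j → Linked m i j ⇔ Linked n (tileMap σ i) (tileMap σ j)
  linked-⇔ i j = mk⇔
    (λ (ij , ji) → to ij , to ji)
    (λ (ij , ji) → from ij , from ji)
    where
    to : ∀ {i j} → Adjacent j (b-partner m i) →
         Adjacent (tileMap σ j) (b-partner n (tileMap σ i))
    to {i} = subst (Adjacent _) (sym (b-partner-preserved i)) ∘ adjacent-preserved σ
    from : ∀ {i j} → Adjacent (tileMap σ j) (b-partner n (tileMap σ i)) →
           Adjacent j (b-partner m i)
    from {i} = adjacent-reflected σ ∘ subst (Adjacent _) (b-partner-preserved i)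

  links-preserved : ∀ i k → links m i k ≡ links n (tileMap σ i) (edge i ⟨$⟩ʳ k)
  links-preserved i k = begin
    links m i k
      ≡⟨ cong (if_then 1 else 0) (does-⇔ (linked-⇔ i _) (linked? m i _) (linked? n _ _)) ⟩
    (if does (linked? n (tileMap σ i) (tileMap σ (neighbour i k))) then 1 else 0)
      ≡⟨ cong (λ j → if does (linked? n (tileMap σ i) j) then 1 else 0) (edge-compatible i k) ⟨
    links n (tileMap σ i) (edge i ⟨$⟩ʳ k) ∎

  -- Each inner sum is reindexed by the edge map of its tile, the outer sum by the permutation of
  -- tiles.
  squaredLinks-preserved : squaredLinks m ≡ squaredLinks n
  squaredLinks-preserved = begin
    squaredLinks m
      ≡⟨ sum-cong-≗ (λ i → cong (_^ 2) (sum-links i)) ⟩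
    sum (λ i → sum (links n (tileMap σ i)) ^ 2)
      ≡⟨ sum-permute (λ i → sum (links n i) ^ 2) tile ⟨
    squaredLinks n ∎
    where
    sum-links : ∀ i → sum (links m i) ≡ sum (links n (tileMap σ i))
    sum-links i = trans (sum-cong-≗ (links-preserved i))
      (sym (sum-permute (links n (tileMap σ i)) (edge i)))

-- The classification: existence, completeness and pairwise inequivalence.

proposition9 : ∀ {ℓ} {L : Set ℓ} {a b : L} → a ≢ b →
    (∀ n → IsEdgeCongruentTiling (tiling a b n) (a ∷ a ∷ a ∷ a ∷ b ∷ [])) ×
    (∀ (t : EdgeLengths L) → IsEdgeCongruentTiling t (a ∷ a ∷ a ∷ a ∷ b ∷ []) →
    ∃[ n ] t ≈ tiling a b n) ×
    (∀ m n → tiling a b m ≈ tiling a b n → m ≡ n)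
proposition9 a≢b =
  (λ n → marks⇒tiling {p = b-position n} (tiling-marks n)) ,
  (λ t isTiling → let p , marks = tiling⇒marks isTiling in
    listed {t = t} {p = p} a≢b marks) ,
  (λ m n m≈n → squaredLinks-injective m n (squaredLinks-preserved a≢b m n m≈n))
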